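{- Let $s\geq2$, $n=2^{s-1}$, let $H\leq\mathbb{F}_2^s$ be a hyperplane, and let $M=[v_0,\ldots,v_{n-1}]$ be a list of $n$ nonzero vectors of $\mathbb{F}_2^s$ with $\sum_{i}v_i=0$. Suppose that exactly two of the indices $i$ satisfy $v_i\in H$ (i.e. $M$ is a zero-sum two-hole instance with respect to $H$), and that every vector occurring in $M$ occurs with even multiplicity. Then $M$ has a Hadamard pair solution, and such a solution can be constructed by reducing to an all-crossing Hall instance on a quotient space of $\mathbb{F}_2^s$, solving that quotient instance by the algorithm BSolution, and lifting the resulting matching.
   Context: A Hadamard pair solution for a list $[v_0,\ldots,v_{N-1}]$ of $N=2^{d-1}$ nonzero vectors of a $d$-dimensional $\mathbb{F}_2$-vector space $V$ is a partition of $V$ into pairs $\{x_i,y_i\}$, $0\leq i<N$, with $x_i+y_i=v_i$ for all $i$. A request $v$ is internal with respect to a hyperplane if it lies in it, crossing otherwise. An all-crossing Hall instance on $V$ is a zero-sum list of $2^{d-1}$ vectors of $V$, all lying outside one fixed hyperplane of $V$. BSolution is a known algorithm which, for every all-crossing Hall instance, explicitly constructs a Hadamard pair solution; it may be treated as a black box with this guarantee. The quotient here is $\mathbb{F}_2^s/L$ with $L=\{0,p\}$ a one-dimensional subspace of $H$; lifting means that a quotient edge $\{X,Y\}$ with $X+Y=v+L$ is replaced by the two parallel edges $\{x,x+v\}$, $\{x+p,x+p+v\}$ ($x\in X$), while a coset $\{x,x+p\}$ not covered by a lifted quotient edge is itself used as a pair. When $s=2$ there are no crossing requests and the quotient step is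 vacuous. -}

module Defs where

open import Algebra.Bundles using (CommutativeMonoid; CommutativeRing; Ring)
open import Algebra.Module.Bundles using (LeftModule)
import Algebra.Definitions.RawMonoid as RawMonoidDefinitions
import Algebra.Properties.AbelianGroup as AbelianGroupProperties
import Algebra.Properties.CommutativeSemigroup as CommutativeSemigroupProperties
open import Data.Bool using (Bool; true; false; _∧_; _xor_)
open import Data.Bool.Properties as Bool using (xor-∧-commutativeRing)
open import Data.Fin using (Fin)
open import Data.Nat using (ℕ; suc; _∸_; _^_)
open import Data.Product using (Σ-syntax; ∃-syntax; _×_; _,_)
open import Data.Sum using (_⊎_; inj₁; inj₂; [_,_]′)
open import Data.Vec as Vec using (Vec; []; _∷_; zipWith; replicate; count; tabulate)
open import Data.Vec.Functional using (Vector)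
import Data.Vec.Properties as Vec
open import Function using (_↔_; id; Inverse)
open import Function.Definitions using (Bijective)
open import Level using (0ℓ)
open import Relation.Binary.Definitions using (DecidableEquality)
open import Relation.Binary.PropositionalEquality
  using (_≡_; _≢_; refl; cong₂; isEquivalence)
open import Relation.Nullary using (¬_)
open import Relation.Unary using (Pred)

-- The field with two elements is Bool, with xor as addition and ∧ as
-- multiplication.
𝔽₂ : Ring 0ℓ 0ℓ
𝔽₂ = CommutativeRing.ring xor-∧-commutativeRing

-- Equality of vectors is a setoid equality, so that a quotient space can have
-- the same carrier as the space it is a quotient of.
VectorSpace : Set₁
VectorSpace = LeftModule 𝔽₂ 0ℓ 0ℓ

Carrier : VectorSpace → Set
Carrier = LeftModule.Carrierᴹ

infix 9 𝔽₂^_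

𝔽₂^_ : ℕ → VectorSpace
𝔽₂^ s = record
  { Carrierᴹ = Vec Bool s
  ; _≈ᴹ_ = _≡_
  ; _+ᴹ_ = zipWith _xor_
  ; _*ₗ_ = λ c → Vec.map (c ∧_)
  ; 0ᴹ = replicate s false
  ; -ᴹ_ = id
  ; isLeftModule = record
    { isLeftSemimodule = record
      { +ᴹ-isCommutativeMonoid = record
        { isMonoid = record
          { isSemigroup = record
            { isMagma = record
              { isEquivalence = isEquivalence
              ; ∙-cong = cong₂ (zipWith _xor_)
              }
            ; assoc = Vec.zipWith-assoc R.+-assoc
            }
          ; identity = Vec.zipWith-identityˡ R.+-identityˡ
                     , Vec.zipWith-identityʳ R.+-identityʳ
          }
        ; comm = Vec.zipWith-comm R.+-comm
        }
      ; isPreleftSemimodule = record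
        { *ₗ-cong = cong₂ (λ c → Vec.map (c ∧_))
        ; *ₗ-zeroˡ = λ v → Vec.map-const v false
        ; *ₗ-distribʳ = distribʳ
        ; *ₗ-identityˡ = Vec.map-id
        ; *ₗ-assoc = assoc
        ; *ₗ-zeroʳ = zeroʳ s
        ; *ₗ-distribˡ = distribˡ
        }
      }
    ; -ᴹ‿cong = id
    ; -ᴹ‿inverse = self-inverse , self-inverse
    }
  }
  where
  module R = CommutativeRing xor-∧-commutativeRing

  distribʳ : ∀ {n} (v : Vec Bool n) c d →
             Vec.map ((c xor d) ∧_) v ≡
             zipWith _xor_ (Vec.map (c ∧_) v) (Vec.map (d ∧_) v)
  distribʳ []      c d = refl
  distribʳ (b ∷ v) c d = cong₂ _∷_ (R.distribʳ b c d) (distribʳ v c d)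

  distribˡ : ∀ {n} c (v w : Vec Bool n) →
             Vec.map (c ∧_) (zipWith _xor_ v w) ≡
             zipWith _xor_ (Vec.map (c ∧_) v) (Vec.map (c ∧_) w)
  distribˡ c []      []      = refl
  distribˡ c (a ∷ v) (b ∷ w) = cong₂ _∷_ (R.distribˡ c a b) (distribˡ c v w)

  assoc : ∀ {n} c d (v : Vec Bool n) →
          Vec.map ((c ∧ d) ∧_) v ≡ Vec.map (c ∧_) (Vec.map (d ∧_) v)
  assoc c d []      = refl
  assoc c d (b ∷ v) = cong₂ _∷_ (R.*-assoc c d b) (assoc c d v)

  zeroʳ : ∀ n c → Vec.map (c ∧_) (replicate n false) ≡ replicate n false
  zeroʳ ℕ.zero  c = refl
  zeroʳ (suc n) c = cong₂ _∷_ (R.zeroʳ c) (zeroʳ n c)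

  self-inverse : ∀ {n} (v : Vec Bool n) → zipWith _xor_ v v ≡ replicate n false
  self-inverse []      = refl
  self-inverse (b ∷ v) = cong₂ _∷_ (Bool.xor-same b) (self-inverse v)

module _ (V : VectorSpace) where
  open LeftModule V
  open RawMonoidDefinitions +ᴹ-rawMonoid using (sum)

  record Subspace : Set₁ where
    field
      member    : Pred Carrierᴹ 0ℓ
      resp-≈    : ∀ {x y} → x ≈ᴹ y → member x → member y
      0-closed  : member 0ᴹ
      +-closed  : ∀ {x y} → member x → member y → member (x +ᴹ y)
      *ₗ-closed : ∀ c {x} → member x → member (c *ₗ x)

  combination : ∀ {d} → Vector Bool d → Vector Carrierᴹ d → Carrierᴹ
  combination c b = sum λ i → c i *ₗ b i

  record HasDimension (d : ℕ) : Set where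
    field
      basis       : Vector Carrierᴹ d
      independent : ∀ c → combination c basis ≈ᴹ 0ᴹ → ∀ i → c i ≡ false
      spanning    : ∀ v → ∃[ c ] combination c basis ≈ᴹ v

private module Properties (V : VectorSpace) where
  open LeftModule V
  open AbelianGroupProperties +ᴹ-abelianGroup public
  open CommutativeSemigroupProperties
    (CommutativeMonoid.commutativeSemigroup +ᴹ-commutativeMonoid) public
    using (interchange)

  -- 1 + 1 = 0 in 𝔽₂
  x+x≈0 : ∀ x → x +ᴹ x ≈ᴹ 0ᴹ
  x+x≈0 x = ≈ᴹ-trans
    (+ᴹ-cong (≈ᴹ-sym (*ₗ-identityˡ x)) (≈ᴹ-sym (*ₗ-identityˡ x)))
    (≈ᴹ-trans (≈ᴹ-sym (*ₗ-distribʳ x true true)) (*ₗ-zeroˡ x))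

  -x≈x : ∀ x → -ᴹ x ≈ᴹ x
  -x≈x x = ≈ᴹ-sym (inverseˡ-unique x x (x+x≈0 x))

-- The quotient V / U has the carrier of V; x and y represent the same coset
-- when x - y lies in U.

infixl 7 _/_

_/_ : (V : VectorSpace) → Subspace V → VectorSpace
V / U = record
  { Carrierᴹ = Carrier V
  ; _≈ᴹ_ = _≈/_
  ; _+ᴹ_ = _+ᴹ_
  ; _*ₗ_ = _*ₗ_
  ; 0ᴹ = 0ᴹ
  ; -ᴹ_ = -ᴹ_
  ; isLeftModule = record
    { isLeftSemimodule = record
      { +ᴹ-isCommutativeMonoid = record
        { isMonoid = record
          { isSemigroup = record
            { isMagma = record
              { isEquivalence = record
                { refl  = ≈⇒≈/ ≈ᴹ-refl
                ; sym   = λ {x} {y} p → resp-≈ (⁻¹-anti-homo‿- x y) (-‿closed p)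
                ; trans = λ {x} {y} {z} p q → resp-≈ (telescope x y z) (+-closed p q)
                }
              ; ∙-cong = λ {x} {y} {u} {v} p q →
                  resp-≈ (sum-of-differences x y u v) (+-closed p q)
              }
            ; assoc = λ x y z → ≈⇒≈/ (+ᴹ-assoc x y z)
            }
          ; identity = (λ x → ≈⇒≈/ (+ᴹ-identityˡ x))
                     , (λ x → ≈⇒≈/ (+ᴹ-identityʳ x))
          }
        ; comm = λ x y → ≈⇒≈/ (+ᴹ-comm x y)
        }
      ; isPreleftSemimodule = record
        { *ₗ-cong = λ { {c} {_} {x} {y} refl p →
            resp-≈ (scaled-difference c x y) (*ₗ-closed c p) }
        ; *ₗ-zeroˡ = λ x → ≈⇒≈/ (*ₗ-zeroˡ x)
        ; *ₗ-distribʳ = λ x c d → ≈⇒≈/ (*ₗ-distribʳ x c d)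
        ; *ₗ-identityˡ = λ x → ≈⇒≈/ (*ₗ-identityˡ x)
        ; *ₗ-assoc = λ c d x → ≈⇒≈/ (*ₗ-assoc c d x)
        ; *ₗ-zeroʳ = λ c → ≈⇒≈/ (*ₗ-zeroʳ c)
        ; *ₗ-distribˡ = λ c x y → ≈⇒≈/ (*ₗ-distribˡ c x y)
        }
      }
    ; -ᴹ‿cong = λ {x} {y} p → resp-≈ (≈ᴹ-sym (⁻¹-∙-comm x (-ᴹ y))) (-‿closed p)
    ; -ᴹ‿inverse = (λ x → ≈⇒≈/ (-ᴹ‿inverseˡ x)) , (λ x → ≈⇒≈/ (-ᴹ‿inverseʳ x))
    }
  }
  where
  open LeftModule V
  open Subspace U
  open Properties V
  open import Relation.Binary.Reasoning.Setoid ≈ᴹ-setoid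

  _≈/_ : Carrier V → Carrier V → Set
  x ≈/ y = member (x +ᴹ -ᴹ y)

  ≈⇒≈/ : ∀ {x y} → x ≈ᴹ y → x ≈/ y
  ≈⇒≈/ {x} {y} p =
    resp-≈ (≈ᴹ-sym (≈ᴹ-trans (+ᴹ-congʳ p) (-ᴹ‿inverseʳ y))) 0-closed

  -‿closed : ∀ {x} → member x → member (-ᴹ x)
  -‿closed {x} = resp-≈ (≈ᴹ-sym (-x≈x x))

  telescope : ∀ x y z → (x +ᴹ -ᴹ y) +ᴹ (y +ᴹ -ᴹ z) ≈ᴹ x +ᴹ -ᴹ z
  telescope x y z = begin
    (x +ᴹ -ᴹ y) +ᴹ (y +ᴹ -ᴹ z)  ≈⟨ +ᴹ-assoc x (-ᴹ y) _ ⟩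
    x +ᴹ (-ᴹ y +ᴹ (y +ᴹ -ᴹ z))  ≈⟨ +ᴹ-congˡ (+ᴹ-assoc (-ᴹ y) y (-ᴹ z)) ⟨
    x +ᴹ ((-ᴹ y +ᴹ y) +ᴹ -ᴹ z)  ≈⟨ +ᴹ-congˡ (+ᴹ-congʳ (-ᴹ‿inverseˡ y)) ⟩
    x +ᴹ (0ᴹ +ᴹ -ᴹ z)           ≈⟨ +ᴹ-congˡ (+ᴹ-identityˡ (-ᴹ z)) ⟩
    x +ᴹ -ᴹ z                   ∎

  sum-of-differences : ∀ x y u v →
    (x +ᴹ -ᴹ y) +ᴹ (u +ᴹ -ᴹ v) ≈ᴹ (x +ᴹ u) +ᴹ -ᴹ (y +ᴹ v)
  sum-of-differences x y u v =
    ≈ᴹ-trans (interchange x (-ᴹ y) u (-ᴹ v)) (+ᴹ-congˡ (⁻¹-∙-comm y v))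

  scaled-difference : ∀ c x y → c *ₗ (x +ᴹ -ᴹ y) ≈ᴹ c *ₗ x +ᴹ -ᴹ (c *ₗ y)
  scaled-difference c x y = begin
    c *ₗ (x +ᴹ -ᴹ y)      ≈⟨ *ₗ-distribˡ c x (-ᴹ y) ⟩
    c *ₗ x +ᴹ c *ₗ -ᴹ y   ≈⟨ +ᴹ-congˡ (*ₗ-congˡ (-x≈x y)) ⟩
    c *ₗ x +ᴹ c *ₗ y      ≈⟨ +ᴹ-congˡ (-x≈x (c *ₗ y)) ⟨
    c *ₗ x +ᴹ -ᴹ (c *ₗ y) ∎

-- A hyperplane is a subspace of codimension one.
IsHyperplane : (V : VectorSpace) → Subspace V → Set
IsHyperplane V H = HasDimension (V / H) 1

-- The subspace {0, p}
line : (V : VectorSpace) → Carrier V → Subspace V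
line V p = record
  { member = λ x → x ≈ᴹ 0ᴹ ⊎ x ≈ᴹ p
  ; resp-≈ = λ { e (inj₁ q) → inj₁ (≈ᴹ-trans (≈ᴹ-sym e) q)
               ; e (inj₂ q) → inj₂ (≈ᴹ-trans (≈ᴹ-sym e) q) }
  ; 0-closed = inj₁ ≈ᴹ-refl
  ; +-closed = λ
    { (inj₁ q) (inj₁ r) → inj₁ (≈ᴹ-trans (+ᴹ-cong q r) (+ᴹ-identityˡ 0ᴹ))
    ; (inj₁ q) (inj₂ r) → inj₂ (≈ᴹ-trans (+ᴹ-cong q r) (+ᴹ-identityˡ p))
    ; (inj₂ q) (inj₁ r) → inj₂ (≈ᴹ-trans (+ᴹ-cong q r) (+ᴹ-identityʳ p))
    ; (inj₂ q) (inj₂ r) → inj₁ (≈ᴹ-trans (+ᴹ-cong q r) (x+x≈0 p)) }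
  ; *ₗ-closed = λ
    { false {x} _        → inj₁ (*ₗ-zeroˡ x)
    ; true  {x} (inj₁ q) → inj₁ (≈ᴹ-trans (*ₗ-identityˡ x) q)
    ; true  {x} (inj₂ q) → inj₂ (≈ᴹ-trans (*ₗ-identityˡ x) q) }
  }
  where
  open LeftModule V
  open Properties V

module _ (V : VectorSpace) where
  open LeftModule V
  open RawMonoidDefinitions +ᴹ-rawMonoid using (sum)

  -- The 2N endpoints of the pairs {x i , y i} enumerate V without repetition.
  record HadamardPairSolution {N : ℕ} (v : Vector Carrierᴹ N) : Set where
    field
      x y       : Vector Carrierᴹ N
      partition : Bijective {A = Fin N ⊎ Fin N} _≡_ _≈ᴹ_ [ x , y ]′
      sums      : ∀ i → x i +ᴹ y i ≈ᴹ v i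

    pair : Fin N → Carrierᴹ × Carrierᴹ
    pair i = x i , y i

  record AllCrossingHallInstance (d : ℕ) : Set₁ where
    field
      request      : Vector Carrierᴹ (2 ^ (d ∸ 1))
      zero-sum     : sum request ≈ᴹ 0ᴹ
      hyperplane   : Subspace V
      isHyperplane : IsHyperplane V hyperplane
      crossing     : ∀ i → ¬ Subspace.member hyperplane (request i)

  -- Equality of unordered pairs
  infix 4 _≈ₚ_
  _≈ₚ_ : Carrierᴹ × Carrierᴹ → Carrierᴹ × Carrierᴹ → Set
  (a , b) ≈ₚ (c , d) = (a ≈ᴹ c × b ≈ᴹ d) ⊎ (a ≈ᴹ d × b ≈ᴹ c)

-- The guarantee of the algorithm BSolution, taken as a black box.
BSolution : Set₁
BSolution = (V : VectorSpace) {d : ℕ} → HasDimension V d →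
            (I : AllCrossingHallInstance V d) →
            HadamardPairSolution V (AllCrossingHallInstance.request I)

module _ (V : VectorSpace) (p : Carrier V) where
  open LeftModule V
  open LeftModule (V / line V p) using () renaming (_≈ᴹ_ to _≈/_)

  IsCoset : Carrier V × Carrier V → Set
  IsCoset e = ∃[ x ] _≈ₚ_ V e (x , x +ᴹ p)

  -- What becomes of a quotient edge {X , Y}, given by representatives X and Y:
  -- two edges of V. Either it is lifted along some v with X + Y = v + L, or it
  -- is not, and then the cosets X and Y are themselves the two edges.
  data EdgeLift (X Y : Carrier V) (e e′ : Carrier V × Carrier V) : Set where
    parallel : ∀ v → X +ᴹ Y ≈/ v →
               _≈ₚ_ V e  (X , X +ᴹ v) →
               _≈ₚ_ V e′ (X +ᴹ p , X +ᴹ p +ᴹ v) →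
               EdgeLift X Y e e′
    cosets   : _≈ₚ_ V e  (X , X +ᴹ p) →
               _≈ₚ_ V e′ (Y , Y +ᴹ p) →
               EdgeLift X Y e e′

  -- The pairs of S are exactly those obtained from the pairs of T; the two
  -- obtained from the pair j have the indices σ (inj₁ j) and σ (inj₂ j). As
  -- S.sums makes M i the sum of the pair i, a pair j lifted along v answers two
  -- requests of M equal to v, and its own request in the quotient is v + L.
  IsLift : ∀ {N′ N} {u : Vector (Carrier V) N′} {M : Vector (Carrier V) N} →
           HadamardPairSolution (V / line V p) u → HadamardPairSolution V M → Set
  IsLift {N′} {N} T S =
    Σ[ σ ∈ (Fin N′ ⊎ Fin N′) ↔ Fin N ] ∀ j →
      EdgeLift (T.x j) (T.y j)
               (S.pair (Inverse.to σ (inj₁ j))) (S.pair (Inverse.to σ (inj₂ j)))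
    where
    module T = HadamardPairSolution T
    module S = HadamardPairSolution S

-- The pairs of S are obtained by lifting, along the quotient by {0 , p}, what
-- the black box returns on an all-crossing Hall instance. For s = 2 the
-- quotient step is vacuous and the pairs are the cosets of {0 , p}.
record ConstructedByLifting (bSolution : BSolution) {s : ℕ} (H : Subspace (𝔽₂^ s))
    {N : ℕ} {M : Vector (Vec Bool s) N} (S : HadamardPairSolution (𝔽₂^ s) M) : Set₁ where
  field
    p   : Vec Bool s
    p∈H : Subspace.member H p
    p≢0 : p ≢ replicate s false

  quotient : VectorSpace
  quotient = 𝔽₂^ s / line (𝔽₂^ s) p

  field
    dimension    : HasDimension quotient (s ∸ 1)
    construction :
      (s ≡ 2 × (∀ i → IsCoset (𝔽₂^ s) p (HadamardPairSolution.pair S i)))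
      ⊎
      (Σ[ I ∈ AllCrossingHallInstance quotient (s ∸ 1) ]
         IsLift (𝔽₂^ s) p (bSolution quotient dimension I) S)

ExactlyTwo : ∀ {n} → Pred (Fin n) 0ℓ → Set
ExactlyTwo P = ∃[ i ] ∃[ j ] i ≢ j × P i × P j × (∀ k → P k → k ≡ i ⊎ k ≡ j)

_≟_ : ∀ {s} → DecidableEquality (Vec Bool s)
_≟_ = Vec.≡-dec Bool._≟_

multiplicity : ∀ {s n} → Vector (Vec Bool s) n → Vec Bool s → ℕ
multiplicity M v = count (_≟ v) (tabulate M)

sumᵥ : ∀ {s n} → Vector (Vec Bool s) n → Vec Bool s
sumᵥ {s} = RawMonoidDefinitions.sum (LeftModule.+ᴹ-rawMonoid (𝔽₂^ s))

{-# OPTIONS --safe #-}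

-- As multiplicities are even, the two requests in H are equal to one vector p
-- and the others fall into pairs of equal crossing requests. For s ≥ 3 keep one
-- request of each crossing pair and put their sum in place of {p , p}: they are
-- 2^(s-2) requests with sum zero in V / {0 , p}, and the added one is crossing
-- because it is a sum of an odd number of crossing vectors. In a solution, the
-- edge of the added request gives two cosets of {0 , p}, which answer p and p;
-- each other edge lifts to two parallel edges. For s = 2 the two cosets of
-- {0 , p} are the solution.

module Submission where

open import Defs
open import Algebra.Bundles using (CommutativeMonoid)
open import Algebra.Module.Bundles using (LeftModule)
import Algebra.Properties.AbelianGroup as AbelianGroupProperties
import Algebra.Properties.CommutativeMonoid.Mult as Mult-properties
import Algebra.Properties.CommutativeMonoid.Sum as Sum-properties
import Algebra.Properties.CommutativeSemigroup as CommutativeSemigroupProperties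
open import Data.Bool using (Bool; true; false; _∧_; _xor_; if_then_else_)
import Data.Bool.Properties as Bool
open import Data.Fin using (Fin; zero; suc; punchIn; punchOut)
import Data.Fin.Properties as Fin
open import Data.Nat using (ℕ; zero; suc; _+_; _≤_; s≤s; _^_; _∸_)
open import Data.Nat.Divisibility using (_∣_; ∣m+n∣m⇒∣n; m∣m*n; ∣1⇒≡1)
import Data.Nat.Properties as ℕ
open import Data.Product using (Σ; Σ-syntax; ∃-syntax; _×_; _,_; proj₁; proj₂)
open import Data.Sum as Sum using (_⊎_; inj₁; inj₂; [_,_]′)
open import Data.Sum.Function.Propositional using (_⊎-↔_)
open import Data.Vec as Vec
  using (Vec; []; _∷_; count; insertAt; lookup; replicate; tabulate; zipWith)
open import Data.Vec.Functional as Vector using (Vector; removeAt; tail; updateAt)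
import Data.Vec.Functional.Properties as Vector
import Data.Vec.Properties as Vec
open import Function using (_∘_; _↔_; id; Inverse; mk↔ₛ′)
open import Function.Construct.Identity using (↔-id)
open import Function.Definitions using (Bijective)
open import Relation.Binary.Definitions using (DecidableEquality)
open import Relation.Binary.PropositionalEquality hiding ([_])
open import Relation.Nullary using (¬_; Dec; yes; no; does; contradiction)
open import Relation.Nullary.Decidable using (dec-true; dec-false)

-- Pairing the positions of a vector whose values have even multiplicity.

module ℕ-sum = Sum-properties ℕ.+-0-commutativeMonoid

module _ {A : Set} (_≟_ : DecidableEquality A) where

  occurs : A → A → ℕ
  occurs v x = if does (x ≟ v) then 1 else 0

  occurrences : ∀ {n} → Vector A n → A → ℕ
  occurrences M v = ℕ-sum.sum (occurs v ∘ M)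

  count-tabulate : ∀ {n} (M : Vector A n) v →
                   count (_≟ v) (tabulate M) ≡ occurrences M v
  count-tabulate {zero}  M v = refl
  count-tabulate {suc n} M v with does (M zero ≟ v)
  ... | true  = cong suc (count-tabulate (tail M) v)
  ... | false = count-tabulate (tail M) v

  -- An absent value would have zero occurrences, and 2 does not divide 1. The `suc` stands for an
  -- entry equal to `v` that has been split off from `M`.
  odd⇒occurs : ∀ {n} (M : Vector A n) v → 2 ∣ suc (occurrences M v) → ∃[ k ] M k ≡ v
  odd⇒occurs {n} M v even with Fin.any? (λ k → M k ≟ v)
  ... | yes found = found
  ... | no absent = contradiction (∣1⇒≡1 (subst (λ m → 2 ∣ suc m) none even)) λ ()
    where
    none : occurrences M v ≡ 0
    none = trans
      (ℕ-sum.sum-cong-≗ λ k →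
        cong (if_then 1 else 0) (dec-false (M k ≟ v) λ e → absent (k , e)))
      (ℕ-sum.sum-replicate-zero n)

private
  -- The step of the recursion in `pairing`: positions `zero` and `suc k` become the new first pair,
  -- and `σ` pairs the positions left after deleting these two, reached through `punchIn k`.
  module Extend {m n} (σ : (Fin m ⊎ Fin m) ↔ Fin n) (k : Fin (suc n)) where
    open Inverse σ renaming (to to σ⟨_⟩; from to σ⁻¹)

    to : Fin (suc m) ⊎ Fin (suc m) → Fin (suc (suc n))
    to (inj₁ zero)    = zero
    to (inj₁ (suc j)) = suc (punchIn k σ⟨ inj₁ j ⟩)
    to (inj₂ zero)    = suc k
    to (inj₂ (suc j)) = suc (punchIn k σ⟨ inj₂ j ⟩)

    to-suc : ∀ a → to (Sum.map suc suc a) ≡ suc (punchIn k σ⟨ a ⟩)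
    to-suc (inj₁ j) = refl
    to-suc (inj₂ j) = refl

    -- The decision is an argument, so that the inverse laws can split on it without unfolding
    -- `k Fin.≟ i`.
    from-suc : ∀ {i} → Dec (k ≡ i) → Fin (suc m) ⊎ Fin (suc m)
    from-suc (yes _)  = inj₂ zero
    from-suc (no k≢i) = Sum.map suc suc (σ⁻¹ (punchOut k≢i))

    from : Fin (suc (suc n)) → Fin (suc m) ⊎ Fin (suc m)
    from zero    = inj₁ zero
    from (suc i) = from-suc (k Fin.≟ i)

    to-from-suc : ∀ {i} (k≟i : Dec (k ≡ i)) → to (from-suc k≟i) ≡ suc i
    to-from-suc (yes k≡i) = cong suc k≡i
    to-from-suc (no k≢i)  = begin
      to (Sum.map suc suc (σ⁻¹ (punchOut k≢i)))     ≡⟨ to-suc (σ⁻¹ (punchOut k≢i)) ⟩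
      suc (punchIn k σ⟨ σ⁻¹ (punchOut k≢i) ⟩)       ≡⟨ cong (suc ∘ punchIn k) (strictlyInverseˡ _) ⟩
      suc (punchIn k (punchOut k≢i))                ≡⟨ cong suc (Fin.punchIn-punchOut k≢i) ⟩
      suc _                                         ∎
      where open ≡-Reasoning

    to-from : ∀ i → to (from i) ≡ i
    to-from zero    = refl
    to-from (suc i) = to-from-suc (k Fin.≟ i)

    from-suc-punchIn : ∀ a (d : Dec (k ≡ punchIn k σ⟨ a ⟩)) → from-suc d ≡ Sum.map suc suc a
    from-suc-punchIn a (yes e)  = contradiction (sym e) (Fin.punchInᵢ≢i k σ⟨ a ⟩)
    from-suc-punchIn a (no k≢i) = cong (Sum.map suc suc) (begin
      σ⁻¹ (punchOut k≢i)  ≡⟨ cong σ⁻¹ (trans (Fin.punchOut-cong k refl) (Fin.punchOut-punchIn k)) ⟩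
      σ⁻¹ σ⟨ a ⟩          ≡⟨ strictlyInverseʳ a ⟩
      a                   ∎)
      where open ≡-Reasoning

    from-suc-self : ∀ (d : Dec (k ≡ k)) → from-suc d ≡ inj₂ zero
    from-suc-self (yes _)  = refl
    from-suc-self (no k≢k) = contradiction refl k≢k

    from-to : ∀ a → from (to a) ≡ a
    from-to (inj₁ zero)    = refl
    from-to (inj₁ (suc j)) = from-suc-punchIn (inj₁ j) (k Fin.≟ _)
    from-to (inj₂ zero)    = from-suc-self (k Fin.≟ k)
    from-to (inj₂ (suc j)) = from-suc-punchIn (inj₂ j) (k Fin.≟ _)

    extension : (Fin (suc m) ⊎ Fin (suc m)) ↔ Fin (suc (suc n))
    extension = mk↔ₛ′ to from to-from from-to

module _ {A : Set} (_≟_ : DecidableEquality A) where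

  Pairing : ∀ {n} → ℕ → Vector A n → Set
  Pairing {n} m M =
    Σ[ σ ∈ (Fin m ⊎ Fin m) ↔ Fin n ]
      ∀ j → M (Inverse.to σ (inj₁ j)) ≡ M (Inverse.to σ (inj₂ j))

  -- By parity the first entry has an equal among the later ones. Deleting both lowers each
  -- multiplicity by 0 or 2, so the remaining multiplicities stay even.
  pairing : ∀ m {n} → n ≡ m + m → (M : Vector A n) →
            (∀ i → 2 ∣ count (_≟ M i) (tabulate M)) → Pairing m M
  pairing m eq M even =
    go m eq M λ i → subst (2 ∣_) (count-tabulate _≟_ M (M i)) (even i)
    where
    -- The recursion uses multiplicities written as sums, from which a term at any position can be
    -- split off.
    go : ∀ m {n} → n ≡ m + m → (M : Vector A n) →
         (∀ i → 2 ∣ occurrences _≟_ M (M i)) → Pairing m M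
    go zero    refl M even = mk↔ₛ′ [ (λ ()) , (λ ()) ]′ (λ ()) (λ ()) Sum.[ (λ ()) , (λ ()) ] , λ ()
    go (suc m) {zero}        () M even
    go (suc m) {suc zero}    eq M even =
      contradiction (trans (ℕ.suc-injective eq) (ℕ.+-suc m m)) λ ()
    go (suc m) {suc (suc n)} eq M even = extend (odd⇒occurs _≟_ (tail M) (M zero) odd)
      where
      odd : 2 ∣ suc (occurrences _≟_ (tail M) (M zero))
      odd = subst (λ b → 2 ∣ (if b then 1 else 0) + occurrences _≟_ (tail M) (M zero))
                  (dec-true (M zero ≟ M zero) refl) (even zero)

      extend : ∃[ k ] M (suc k) ≡ M zero → Pairing (suc m) M
      extend (k , Mk≡M0) = Extend.extension σ k , λ { zero → sym Mk≡M0 ; (suc j) → equal j }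
        where
        rest : Vector A n
        rest = removeAt (tail M) k

        occurrences-rest : ∀ v → occurrences _≟_ M v ≡
                           occurs _≟_ v (M zero) + occurs _≟_ v (M zero) + occurrences _≟_ rest v
        occurrences-rest v = begin
          o (M zero) + occurrences _≟_ (tail M) v
            ≡⟨ cong (o (M zero) +_) (ℕ-sum.sum-remove {i = k} (o ∘ tail M)) ⟩
          o (M zero) + (o (M (suc k)) + occurrences _≟_ rest v)
            ≡⟨ cong (λ x → o (M zero) + (o x + occurrences _≟_ rest v)) Mk≡M0 ⟩
          o (M zero) + (o (M zero) + occurrences _≟_ rest v)
            ≡⟨ ℕ.+-assoc (o (M zero)) _ _ ⟨
          o (M zero) + o (M zero) + occurrences _≟_ rest v ∎
          where
          open ≡-Reasoning
          o = occurs _≟_ v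

        even-rest : ∀ i → 2 ∣ occurrences _≟_ rest (rest i)
        even-rest i = ∣m+n∣m⇒∣n
          (subst (2 ∣_) (occurrences-rest (rest i)) (even (suc (punchIn k i))))
          (subst (2 ∣_) (cong (o +_) (ℕ.+-identityʳ o)) (m∣m*n o))
          where o = occurs _≟_ (rest i) (M zero)

        n≡m+m : n ≡ m + m
        n≡m+m = ℕ.suc-injective (trans (ℕ.suc-injective eq) (ℕ.+-suc m m))

        IH = go m n≡m+m rest even-rest
        open Σ IH renaming (proj₁ to σ; proj₂ to equal)

-- Sums and arithmetic in vector spaces over the two-element field.

module _ {c ℓ} (𝕄 : CommutativeMonoid c ℓ) where
  open CommutativeMonoid 𝕄 renaming (Carrier to A; trans to ≈-trans; sym to ≈-sym)
  open Sum-properties 𝕄 using (sum)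
  open CommutativeSemigroupProperties commutativeSemigroup using (xy∙z≈xz∙y)

  sum-updateAt : ∀ {n} (w : Vector A n) j a → sum (updateAt w j (_∙ a)) ≈ sum w ∙ a
  sum-updateAt w zero    a = xy∙z≈xz∙y _ _ _
  sum-updateAt w (suc j) a = ≈-trans (∙-congˡ (sum-updateAt (tail w) j a)) (≈-sym (assoc _ _ _))

module CharacteristicTwo (V : VectorSpace) where
  open LeftModule V public
  open AbelianGroupProperties +ᴹ-abelianGroup public
    using (inverseˡ-unique; x∙y⁻¹≈ε⇒x≈y; ∙-cancelʳ; ε⁻¹≈ε)
  open CommutativeSemigroupProperties
    (CommutativeMonoid.commutativeSemigroup +ᴹ-commutativeMonoid) public
    using (xy∙z≈xz∙y)
  open Sum-properties +ᴹ-commutativeMonoid public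
    using (sum; sum-cong-≋; sum-replicate)
  open Mult-properties +ᴹ-commutativeMonoid public using (×-homo-+)

  x+x≈0 : ∀ x → x +ᴹ x ≈ᴹ 0ᴹ
  x+x≈0 x = begin
    x +ᴹ x                  ≈⟨ +ᴹ-cong (*ₗ-identityˡ x) (*ₗ-identityˡ x) ⟨
    true *ₗ x +ᴹ true *ₗ x  ≈⟨ *ₗ-distribʳ x true true ⟨
    false *ₗ x              ≈⟨ *ₗ-zeroˡ x ⟩
    0ᴹ                      ∎
    where open import Relation.Binary.Reasoning.Setoid ≈ᴹ-setoid

  -x≈x : ∀ x → -ᴹ x ≈ᴹ x
  -x≈x x = ≈ᴹ-sym (inverseˡ-unique x x (x+x≈0 x))

  x+y+y≈x : ∀ x y → x +ᴹ y +ᴹ y ≈ᴹ x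
  x+y+y≈x x y =
    ≈ᴹ-trans (+ᴹ-assoc x y y) (≈ᴹ-trans (+ᴹ-congˡ (x+x≈0 y)) (+ᴹ-identityʳ x))

  x+[x+y]≈y : ∀ x y → x +ᴹ (x +ᴹ y) ≈ᴹ y
  x+[x+y]≈y x y =
    ≈ᴹ-trans (≈ᴹ-sym (+ᴹ-assoc x x y)) (≈ᴹ-trans (+ᴹ-congʳ (x+x≈0 x)) (+ᴹ-identityˡ y))

  x+y≈z⇒y≈x+z : ∀ {x y z} → x +ᴹ y ≈ᴹ z → y ≈ᴹ x +ᴹ z
  x+y≈z⇒y≈x+z {x} {y} e = ≈ᴹ-trans (≈ᴹ-sym (x+[x+y]≈y x y)) (+ᴹ-congˡ e)

-- Applied to two quotients: by a hyperplane, where the crossing vectors are those with nonzero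
-- class, and of the plane by `{0 , p}` when `s` is 2.
module DimensionOne (V : VectorSpace) (dim : HasDimension V 1) where
  open CharacteristicTwo V
  open HasDimension dim

  generator : Carrierᴹ
  generator = basis zero

  combination≈ : ∀ c → combination V c basis ≈ᴹ c zero *ₗ generator
  combination≈ c = +ᴹ-identityʳ _

  generator≉0 : ¬ generator ≈ᴹ 0ᴹ
  generator≉0 b≈0 = contradiction (independent (λ _ → true) vanishes zero) λ ()
    where
    vanishes : combination V (λ _ → true) basis ≈ᴹ 0ᴹ
    vanishes = ≈ᴹ-trans (combination≈ (λ _ → true)) (≈ᴹ-trans (*ₗ-identityˡ _) b≈0)

  elements : ∀ v → v ≈ᴹ 0ᴹ ⊎ v ≈ᴹ generator
  elements v with spanning v
  ... | c , e = case (c zero) (≈ᴹ-trans (≈ᴹ-sym e) (combination≈ c))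
    where
    case : ∀ a → v ≈ᴹ a *ₗ generator → v ≈ᴹ 0ᴹ ⊎ v ≈ᴹ generator
    case false e = inj₁ (≈ᴹ-trans e (*ₗ-zeroˡ _))
    case true  e = inj₂ (≈ᴹ-trans e (*ₗ-identityˡ _))

  solution : HadamardPairSolution V {1} (λ _ → generator)
  solution = record
    { x         = x
    ; y         = y
    ; partition = injective , surjective
    ; sums      = λ _ → +ᴹ-identityˡ generator
    }
    where
    x y : Vector Carrierᴹ 1
    x _ = 0ᴹ
    y _ = generator

    injective : ∀ {a b} → [ x , y ]′ a ≈ᴹ [ x , y ]′ b → a ≡ b
    injective {inj₁ zero} {inj₁ zero} _   = refl
    injective {inj₁ zero} {inj₂ zero} 0≈b = contradiction (≈ᴹ-sym 0≈b) generator≉0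
    injective {inj₂ zero} {inj₁ zero} b≈0 = contradiction b≈0 generator≉0
    injective {inj₂ zero} {inj₂ zero} _   = refl

    surjective : ∀ v → ∃[ a ] (∀ {z} → z ≡ a → [ x , y ]′ z ≈ᴹ v)
    surjective v with elements v
    ... | inj₁ v≈0 = inj₁ zero , λ { refl → ≈ᴹ-sym v≈0 }
    ... | inj₂ v≈b = inj₂ zero , λ { refl → ≈ᴹ-sym v≈b }

  -- An odd number of the summands is equal to the generator.
  sum-with-one-zero : ∀ {N} n → N ≡ n + n → (w : Vector Carrierᴹ N) (j : Fin N) →
    w j ≈ᴹ 0ᴹ → (∀ i → i ≢ j → ¬ w i ≈ᴹ 0ᴹ) → ¬ sum w ≈ᴹ 0ᴹ
  sum-with-one-zero n refl w j wj≈0 wi≉0 sum≈0 = generator≉0 (begin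
    generator                              ≈⟨ +ᴹ-identityˡ _ ⟨
    0ᴹ +ᴹ generator                        ≈⟨ +ᴹ-congʳ constant-sum ⟨
    sum constant +ᴹ generator              ≈⟨ sum-updateAt +ᴹ-commutativeMonoid constant j generator ⟨
    sum (updateAt constant j (_+ᴹ generator))  ≈⟨ sum-cong-≋ w-values ⟨
    sum w                                  ≈⟨ sum≈0 ⟩
    0ᴹ                                     ∎)
    where
    open import Relation.Binary.Reasoning.Setoid ≈ᴹ-setoid

    -- An even number of generators sums to 0. Adding one more generator at `j` makes that entry 0,
    -- which gives exactly the values of `w`.
    constant : Vector Carrierᴹ (n + n)
    constant = Vector.replicate (n + n) generator

    constant-sum : sum constant ≈ᴹ 0ᴹ
    constant-sum = ≈ᴹ-trans (sum-replicate (n + n))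
      (≈ᴹ-trans (×-homo-+ generator n n) (x+x≈0 _))

    w-values : ∀ i → w i ≈ᴹ updateAt constant j (_+ᴹ generator) i
    w-values i with i Fin.≟ j
    ... | yes refl = ≈ᴹ-trans wj≈0
      (≈ᴹ-trans (≈ᴹ-sym (x+x≈0 generator))
        (≈ᴹ-reflexive (sym (Vector.updateAt-updates i constant))))
    ... | no i≢j with elements (w i)
    ...   | inj₁ wi≈0 = contradiction wi≈0 (wi≉0 i i≢j)
    ...   | inj₂ wi≈b = ≈ᴹ-trans wi≈b
      (≈ᴹ-reflexive (sym (Vector.updateAt-minimal i j constant i≢j)))

-- Cosets, and the dimension of the quotient by a line.

module _ (V : VectorSpace) (U : Subspace V) where
  open CharacteristicTwo V
  open Subspace U
  open LeftModule (V / U) using () renaming (_≈ᴹ_ to _≈/_)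

  member⇒≈/0 : ∀ {x} → member x → x ≈/ 0ᴹ
  member⇒≈/0 m = resp-≈ (≈ᴹ-sym (≈ᴹ-trans (+ᴹ-congˡ ε⁻¹≈ε) (+ᴹ-identityʳ _))) m

  ≈/0⇒member : ∀ {x} → x ≈/ 0ᴹ → member x
  ≈/0⇒member m = resp-≈ (≈ᴹ-trans (+ᴹ-congˡ ε⁻¹≈ε) (+ᴹ-identityʳ _)) m

  ≈⇒≈/ : ∀ {x y} → x ≈ᴹ y → x ≈/ y
  ≈⇒≈/ x≈y = resp-≈ (≈ᴹ-sym (≈ᴹ-trans (+ᴹ-congʳ x≈y) (-ᴹ‿inverseʳ _))) 0-closed

module _ (V : VectorSpace) (p : Carrier V) where
  open CharacteristicTwo V
  open LeftModule (V / line V p) using () renaming (_≈ᴹ_ to _≈/_)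

  ≈/⇒≈⊎≈+p : ∀ {x y} → x ≈/ y → x ≈ᴹ y ⊎ x ≈ᴹ y +ᴹ p
  ≈/⇒≈⊎≈+p (inj₁ x-y≈0) = inj₁ (x∙y⁻¹≈ε⇒x≈y _ _ x-y≈0)
  ≈/⇒≈⊎≈+p {x} {y} (inj₂ x-y≈p) = inj₂ (x+y≈z⇒y≈x+z
    (≈ᴹ-trans (+ᴹ-comm y x) (≈ᴹ-trans (+ᴹ-congˡ (≈ᴹ-sym (-x≈x y))) x-y≈p)))

  x+p≈/x : ∀ x → x +ᴹ p ≈/ x
  x+p≈/x x = inj₂ (≈ᴹ-trans (+ᴹ-congˡ (-x≈x x))
    (≈ᴹ-trans (+ᴹ-comm _ x) (x+[x+y]≈y x p)))

-- Inserting a zero coordinate is a linear map. Position `zero` serves the recursion for the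
-- standard basis, a general `k` the basis of the quotient by a line.
insert-combination : ∀ {d n} k (c : Vector Bool d) (b : Vector (Vec Bool n) d) →
  combination (𝔽₂^ suc n) c (λ j → insertAt (b j) k false) ≡
  insertAt (combination (𝔽₂^ n) c b) k false
insert-combination {zero} {n} k c b = zero-insert n k
  where
  zero-insert : ∀ n k → replicate (suc n) false ≡ insertAt (replicate n false) k false
  zero-insert n       zero    = refl
  zero-insert (suc n) (suc k) = cong (false ∷_) (zero-insert n k)
insert-combination {suc d} {n} k c b = begin
  Vec.map (c₀ ∧_) (insertAt b₀ k false) ⊕ combination (𝔽₂^ suc n) (tail c) (λ j → insertAt (b (suc j)) k false)
    ≡⟨ cong₂ _⊕_ (Vec.map-insertAt (c₀ ∧_) false b₀ k) (insert-combination k (tail c) (tail b)) ⟩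
  insertAt (Vec.map (c₀ ∧_) b₀) k (c₀ ∧ false) ⊕ insertAt (combination (𝔽₂^ n) (tail c) (tail b)) k false
    ≡⟨ zipWith-insertAt _ _ k ⟩
  insertAt (Vec.map (c₀ ∧_) b₀ ⊕ combination (𝔽₂^ n) (tail c) (tail b)) k ((c₀ ∧ false) xor false)
    ≡⟨ cong (insertAt _ k) (trans (Bool.xor-identityʳ _) (Bool.∧-zeroʳ c₀)) ⟩
  insertAt (Vec.map (c₀ ∧_) b₀ ⊕ combination (𝔽₂^ n) (tail c) (tail b)) k false ∎
  where
  open ≡-Reasoning
  c₀ = c zero
  b₀ = b zero

  _⊕_ : ∀ {n} → Vec Bool n → Vec Bool n → Vec Bool n
  _⊕_ = zipWith _xor_

  zipWith-insertAt : ∀ {n} (v w : Vec Bool n) k {x y} →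
    insertAt v k x ⊕ insertAt w k y ≡ insertAt (v ⊕ w) k (x xor y)
  zipWith-insertAt v       w       zero    = refl
  zipWith-insertAt (a ∷ v) (b ∷ w) (suc k) = cong ((a xor b) ∷_) (zipWith-insertAt v w k)

-- The standard basis.
unit : ∀ n → Vector (Vec Bool n) n
unit (suc n) zero    = true ∷ replicate n false
unit (suc n) (suc i) = insertAt (unit n i) zero false

combination-unit : ∀ n c → combination (𝔽₂^ n) c (unit n) ≡ tabulate c
combination-unit zero    c = refl
combination-unit (suc n) c = begin
  zipWith _xor_ (Vec.map (c zero ∧_) (unit (suc n) zero)) (combination (𝔽₂^ suc n) (tail c) (λ j → false ∷ unit n j))
    ≡⟨ cong (zipWith _xor_ _) (insert-combination zero (tail c) (unit n)) ⟩
  ((c zero ∧ true) xor false) ∷ zipWith _xor_ (Vec.map (c zero ∧_) (replicate n false)) (combination (𝔽₂^ n) (tail c) (unit n))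
    ≡⟨ cong₂ _∷_ (trans (Bool.xor-identityʳ _) (Bool.∧-identityʳ _))
        (cong₂ (zipWith _xor_) (LeftModule.*ₗ-zeroʳ (𝔽₂^ n) (c zero)) (combination-unit n (tail c))) ⟩
  c zero ∷ zipWith _xor_ (replicate n false) (tabulate (tail c))
    ≡⟨ cong (c zero ∷_) (LeftModule.+ᴹ-identityˡ (𝔽₂^ n) _) ⟩
  tabulate c ∎
  where open ≡-Reasoning

pivot : ∀ {n} (p : Vec Bool n) → p ≢ replicate n false → ∃[ k ] lookup p k ≡ true
pivot []          p≢0 = contradiction refl p≢0
pivot (true ∷ p)  p≢0 = zero , refl
pivot (false ∷ p) p≢0 with pivot p (p≢0 ∘ cong (false ∷_))
... | k , pₖ≡1 = suc k , pₖ≡1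

-- Each coset of {0 , p} has exactly one member that vanishes at a pivot of p.
line-quotient-dimension : ∀ m (p : Vec Bool (suc m)) → p ≢ replicate (suc m) false →
  HasDimension (𝔽₂^ suc m / line (𝔽₂^ suc m) p) m
line-quotient-dimension m p p≢0 = record
  { basis       = basis
  ; independent = independent
  ; spanning    = spanning
  }
  where
  V = 𝔽₂^ suc m
  open CharacteristicTwo V using (_+ᴹ_)
  open LeftModule (V / line V p) using (_≈ᴹ_)

  k = proj₁ (pivot p p≢0)
  pₖ≡1 = proj₂ (pivot p p≢0)

  basis : Vector (Vec Bool (suc m)) m
  basis j = insertAt (unit m j) k false

  combination≡ : ∀ c → combination V c basis ≡ insertAt (tabulate c) k false
  combination≡ c =
    trans (insert-combination k c (unit m)) (cong (λ v → insertAt v k false) (combination-unit m c))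

  lookup-zero : ∀ i → lookup (replicate (suc m) false) i ≡ false
  lookup-zero i = Vec.lookup-replicate i false

  independent : ∀ c → combination V c basis ≈ᴹ replicate (suc m) false → ∀ i → c i ≡ false
  independent c combination≈0 i
    with ≈/⇒≈⊎≈+p V p (subst (_≈ᴹ replicate (suc m) false) (combination≡ c) combination≈0)
  ... | inj₁ e = begin
    c i                                                 ≡⟨ Vec.lookup∘tabulate c i ⟨
    lookup (tabulate c) i                               ≡⟨ Vec.insertAt-punchIn (tabulate c) k false i ⟨
    lookup (insertAt (tabulate c) k false) (punchIn k i)  ≡⟨ cong (λ v → lookup v (punchIn k i)) e ⟩
    lookup (replicate (suc m) false) (punchIn k i)      ≡⟨ lookup-zero (punchIn k i) ⟩
    false                                               ∎
    where open ≡-Reasoning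
  -- The combination would be `p`, but it vanishes at the pivot, where `p` is 1.
  ... | inj₂ e = contradiction (begin
    false                                          ≡⟨ Vec.insertAt-lookup (tabulate c) k false ⟨
    lookup (insertAt (tabulate c) k false) k       ≡⟨ cong (λ v → lookup v k) e ⟩
    lookup (replicate (suc m) false +ᴹ p) k        ≡⟨ cong (λ v → lookup v k) (LeftModule.+ᴹ-identityˡ V p) ⟩
    lookup p k                                     ≡⟨ pₖ≡1 ⟩
    true                                           ∎) λ ()
    where open ≡-Reasoning

  spanning-at : ∀ v → lookup v k ≡ false → ∃[ c ] combination V c basis ≡ v
  spanning-at v vₖ≡0 = c , (begin
    combination V c basis                              ≡⟨ combination≡ c ⟩
    insertAt (tabulate c) k false                      ≡⟨ cong₂ (λ x → insertAt x k) (Vec.tabulate∘lookup _) (sym vₖ≡0) ⟩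
    insertAt (Vec.removeAt v k) k (lookup v k)         ≡⟨ Vec.insertAt-removeAt v k ⟩
    v                                                  ∎)
    where
    open ≡-Reasoning
    c = lookup (Vec.removeAt v k)

  spanning : ∀ v → ∃[ c ] combination V c basis ≈ᴹ v
  spanning v with lookup v k in vₖ
  ... | false with spanning-at v vₖ
  ...   | c , e = c , ≈⇒≈/ V (line V p) e
  -- Here `v +ᴹ p` is the member of the coset of `v` that vanishes at the pivot.
  spanning v | true
    with spanning-at (v +ᴹ p) (trans (Vec.lookup-zipWith _xor_ k v p) (cong₂ _xor_ vₖ pₖ≡1))
  ...   | c , e = c , subst (_≈ᴹ v) (sym e) (x+p≈/x V p v)

-- Lifting a solution from the quotient.

module _ (V : VectorSpace) where
  open CharacteristicTwo V

  -- Used in three ways below: to change coset representatives, to regroup endpoints into edges, and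
  -- to renumber the edges by `σ`.
  Bijective-resp : ∀ {A B : Set} {f : B → Carrierᴹ} {g : A → Carrierᴹ} (R : A ↔ B) →
    (∀ a → f (Inverse.to R a) ≈ᴹ g a) → Bijective _≡_ _≈ᴹ_ g → Bijective _≡_ _≈ᴹ_ f
  Bijective-resp {f = f} {g} R f∘R≈g (injective , surjective) = injective′ , surjective′
    where
    open Inverse R

    f≈g∘R⁻¹ : ∀ b → f b ≈ᴹ g (from b)
    f≈g∘R⁻¹ b = subst (λ x → f x ≈ᴹ g (from b)) (strictlyInverseˡ b) (f∘R≈g (from b))

    injective′ : ∀ {x y} → f x ≈ᴹ f y → x ≡ y
    injective′ {x} {y} e =
      trans (sym (strictlyInverseˡ x)) (trans (cong to from-x≡from-y) (strictlyInverseˡ y))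
      where
      from-x≡from-y : from x ≡ from y
      from-x≡from-y =
        injective (≈ᴹ-trans (≈ᴹ-sym (f≈g∘R⁻¹ x)) (≈ᴹ-trans e (f≈g∘R⁻¹ y)))

    surjective′ : ∀ v → ∃[ x ] (∀ {z} → z ≡ x → f z ≈ᴹ v)
    surjective′ v with surjective v
    ... | a , ga≈v = to a , λ { refl → ≈ᴹ-trans (f∘R≈g a) (ga≈v refl) }

module _ (V : VectorSpace) (p : Carrier V) where
  open CharacteristicTwo V
  open LeftModule (V / line V p) using () renaming (_≈ᴹ_ to _≈/_; ≈ᴹ-sym to ≈/-sym; ≈ᴹ-trans to ≈/-trans)

  -- A system of representatives and its translate by `p` together fill the space: every coset is
  -- `{x , x + p}`, and its two members differ because `p` is nonzero.
  lift-bijective : ¬ p ≈ᴹ 0ᴹ → ∀ {Q : Set} {t : Q → Carrierᴹ} → Bijective _≡_ _≈/_ t →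
    Bijective _≡_ _≈ᴹ_ [ t , (λ q → t q +ᴹ p) ]′
  lift-bijective p≉0 {Q} {t} (injective , surjective) = injective′ , surjective′
    where
    t′ : Q ⊎ Q → Carrierᴹ
    t′ = [ t , (λ q → t q +ᴹ p) ]′

    mixed : ∀ q q′ → ¬ t q ≈ᴹ t q′ +ᴹ p
    mixed q q′ e with injective {q} {q′} (≈/-trans (≈⇒≈/ V (line V p) e) (x+p≈/x V p (t q′)))
    ... | refl = p≉0 (≈ᴹ-trans (x+y≈z⇒y≈x+z (≈ᴹ-sym e)) (x+x≈0 (t q)))

    injective′ : ∀ {a b} → t′ a ≈ᴹ t′ b → a ≡ b
    injective′ {inj₁ q} {inj₁ q′} e = cong inj₁ (injective (≈⇒≈/ V (line V p) e))
    injective′ {inj₁ q} {inj₂ q′} e = contradiction e (mixed q q′)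
    injective′ {inj₂ q} {inj₁ q′} e = contradiction (≈ᴹ-sym e) (mixed q′ q)
    injective′ {inj₂ q} {inj₂ q′} e =
      cong inj₂ (injective (≈⇒≈/ V (line V p) (∙-cancelʳ p (t q) (t q′) e)))

    surjective′ : ∀ v → ∃[ a ] (∀ {z} → z ≡ a → t′ z ≈ᴹ v)
    surjective′ v with surjective v
    ... | q , tq≈/v with ≈/⇒≈⊎≈+p V p (≈/-sym {t q} {v} (tq≈/v refl))
    ...   | inj₁ v≈tq   = inj₁ q , λ { refl → ≈ᴹ-sym v≈tq }
    ...   | inj₂ v≈tq+p = inj₂ q , λ { refl → ≈ᴹ-sym v≈tq+p }

  coset-pair : ∀ {x y} → x +ᴹ y ≈ᴹ p → IsCoset V p (x , y)
  coset-pair {x} x+y≈p = x , inj₁ (≈ᴹ-refl , x+y≈z⇒y≈x+z x+y≈p)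

  -- M (σ (inj₁ j)) and M (σ (inj₂ j)) are the requests answered by the two
  -- edges obtained from the quotient edge j.
  module Lift (p≉0 : ¬ p ≈ᴹ 0ᴹ) {N′ N} {u : Vector Carrierᴹ N′} (M : Vector Carrierᴹ N)
    (T : HadamardPairSolution (V / line V p) u) (σ : (Fin N′ ⊎ Fin N′) ↔ Fin N)
    (equal : ∀ j → M (Inverse.to σ (inj₁ j)) ≈ᴹ M (Inverse.to σ (inj₂ j)))
    (kind : ∀ j → u j ≈/ M (Inverse.to σ (inj₁ j)) ⊎ M (Inverse.to σ (inj₁ j)) ≈ᴹ p)
    where

    open Inverse σ using (strictlyInverseʳ) renaming (to to σ⟨_⟩; from to σ⁻¹)
    module T = HadamardPairSolution T

    request : Fin N′ → Carrierᴹ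
    request j = M σ⟨ inj₁ j ⟩

    start : Fin N′ ⊎ Fin N′ → Carrierᴹ
    start (inj₁ j) = T.x j
    start (inj₂ j) = [ (λ _ → T.x j +ᴹ p) , (λ _ → T.y j) ]′ (kind j)

    -- The second endpoint is forced by the request, so `sums` holds by construction and what
    -- remains to be proved is `partition`.
    x y : Vector Carrierᴹ N
    x i = start (σ⁻¹ i)
    y i = x i +ᴹ M i

    -- In a parallel lift the edge from `T.x j` ends in the coset of `T.y j`, but possibly at
    -- `T.y j +ᴹ p`; this is the representative it really reaches.
    y′ : Fin N′ → Carrierᴹ
    y′ j = [ (λ _ → T.x j +ᴹ request j) , (λ _ → T.y j) ]′ (kind j)

    y≈/y′ : ∀ j → T.y j ≈/ y′ j
    y≈/y′ j with kind j
    ... | inj₁ u≈/M = CharacteristicTwo.x+y≈z⇒y≈x+z (V / line V p) {T.x j} {T.y j} {request j}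
                        (≈/-trans {T.x j +ᴹ T.y j} {u j} {request j} (T.sums j) u≈/M)
    ... | inj₂ _    = ≈⇒≈/ V (line V p) (≈ᴹ-refl {T.y j})

    representatives : Bijective _≡_ _≈/_ [ T.x , y′ ]′
    representatives = Bijective-resp (V / line V p) {f = [ T.x , y′ ]′} {g = [ T.x , T.y ]′} (↔-id _)
      (λ { (inj₁ j) → ≈⇒≈/ V (line V p) (≈ᴹ-refl {T.x j})
         ; (inj₂ j) → ≈/-sym {T.y j} {y′ j} (y≈/y′ j) })
      T.partition

    -- A quotient edge is turned into the four vectors X, Y, X + p, Y + p; a
    -- parallel lift pairs X with Y and X + p with Y + p, and cosets pair X with
    -- X + p and Y with Y + p.
    exchange : (Fin N′ ⊎ Fin N′) ⊎ (Fin N′ ⊎ Fin N′) → (Fin N′ ⊎ Fin N′) ⊎ (Fin N′ ⊎ Fin N′)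
    exchange (inj₁ (inj₁ j)) = inj₁ (inj₁ j)
    exchange (inj₁ (inj₂ j)) = [ (λ _ → inj₂ (inj₁ j)) , (λ _ → inj₁ (inj₂ j)) ]′ (kind j)
    exchange (inj₂ (inj₁ j)) = [ (λ _ → inj₁ (inj₂ j)) , (λ _ → inj₂ (inj₁ j)) ]′ (kind j)
    exchange (inj₂ (inj₂ j)) = inj₂ (inj₂ j)

    exchange-involutive : ∀ a → exchange (exchange a) ≡ a
    exchange-involutive (inj₁ (inj₁ j)) = refl
    exchange-involutive (inj₂ (inj₂ j)) = refl
    exchange-involutive (inj₁ (inj₂ j)) with kind j in eq
    ... | inj₁ _ rewrite eq = refl
    ... | inj₂ _ rewrite eq = refl
    exchange-involutive (inj₂ (inj₁ j)) with kind j in eq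
    ... | inj₁ _ rewrite eq = refl
    ... | inj₂ _ rewrite eq = refl

    endpoint : (Fin N′ ⊎ Fin N′) ⊎ (Fin N′ ⊎ Fin N′) → Carrierᴹ
    endpoint = [ start , (λ a → start a +ᴹ M σ⟨ a ⟩) ]′

    -- The left side lists first and second endpoints of edges, the right side representatives and
    -- their translates by `p`; `exchange` matches the two listings.
    endpoint-exchange : ∀ a → endpoint (exchange a) ≈ᴹ
      [ [ T.x , y′ ]′ , (λ q → [ T.x , y′ ]′ q +ᴹ p) ]′ a
    endpoint-exchange (inj₁ (inj₁ j)) = ≈ᴹ-refl
    endpoint-exchange (inj₁ (inj₂ j)) with kind j in eq
    ... | inj₁ _ = ≈ᴹ-refl
    ... | inj₂ _ rewrite eq = ≈ᴹ-refl
    endpoint-exchange (inj₂ (inj₁ j)) with kind j in eq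
    ... | inj₁ _ rewrite eq = ≈ᴹ-refl
    ... | inj₂ M≈p = +ᴹ-congˡ M≈p
    endpoint-exchange (inj₂ (inj₂ j)) with kind j in eq
    -- The parallel edge ends at `X + p + v`, which is `X + v + p` because both edges answer the
    -- same vector `v`.
    ... | inj₁ _   = ≈ᴹ-trans (+ᴹ-congˡ (≈ᴹ-sym (equal j))) (xy∙z≈xz∙y _ _ _)
    ... | inj₂ M≈p = +ᴹ-congˡ (≈ᴹ-trans (≈ᴹ-sym (equal j)) M≈p)

    endpoint-σ : ∀ a → [ x , y ]′ (Inverse.to (σ ⊎-↔ σ) a) ≈ᴹ endpoint a
    endpoint-σ (inj₁ a) rewrite strictlyInverseʳ a = ≈ᴹ-refl
    endpoint-σ (inj₂ a) rewrite strictlyInverseʳ a = ≈ᴹ-refl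

    endpoint-bijective : Bijective _≡_ _≈ᴹ_ endpoint
    endpoint-bijective = Bijective-resp V
      (mk↔ₛ′ exchange exchange exchange-involutive exchange-involutive)
      endpoint-exchange (lift-bijective p≉0 representatives)

    solution : HadamardPairSolution V M
    solution = record
      { x         = x
      ; y         = y
      ; partition = Bijective-resp V (σ ⊎-↔ σ) endpoint-σ endpoint-bijective
      ; sums      = λ i → x+[x+y]≈y (x i) (M i)
      }

    isLift : IsLift V p T solution
    isLift = σ , edgeLift
      where
      open HadamardPairSolution solution using (pair)

      pair-σ : ∀ a → pair σ⟨ a ⟩ ≡ (start a , start a +ᴹ M σ⟨ a ⟩)
      pair-σ a rewrite strictlyInverseʳ a = refl

      edgeLift : ∀ j → EdgeLift V p (T.x j) (T.y j) (pair σ⟨ inj₁ j ⟩) (pair σ⟨ inj₂ j ⟩)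
      edgeLift j rewrite pair-σ (inj₁ j) | pair-σ (inj₂ j) with kind j
      ... | inj₁ u≈/M = parallel (request j) (≈/-trans {T.x j +ᴹ T.y j} {u j} {request j} (T.sums j) u≈/M)
                          (inj₁ (≈ᴹ-refl , ≈ᴹ-refl))
                          (inj₁ (≈ᴹ-refl , +ᴹ-congˡ (≈ᴹ-sym (equal j))))
      ... | inj₂ M≈p  = cosets
                          (inj₁ (≈ᴹ-refl , +ᴹ-congˡ M≈p))
                          (inj₁ (≈ᴹ-refl , +ᴹ-congˡ (≈ᴹ-trans (≈ᴹ-sym (equal j)) M≈p)))

-- The all-crossing instance in the quotient.

module _ (V : VectorSpace) {p : Carrier V} (H : Subspace V) (p∈H : Subspace.member H p) where
  open CharacteristicTwo V
  open Subspace H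

  -- As `p` lies in `H`, membership in `H` is constant on cosets of `{0 , p}`, so the same predicate
  -- describes `H / {0 , p}`.
  image : Subspace (V / line V p)
  image = record
    { member    = member
    ; resp-≈    = resp-coset
    ; 0-closed  = 0-closed
    ; +-closed  = +-closed
    ; *ₗ-closed = *ₗ-closed
    }
    where
    open LeftModule (V / line V p) using () renaming (_≈ᴹ_ to _≈/_)

    resp-coset : ∀ {x y} → x ≈/ y → member x → member y
    resp-coset {x} {y} x≈/y x∈H with ≈/⇒≈⊎≈+p V p {x} {y} x≈/y
    ... | inj₁ x≈y   = resp-≈ x≈y x∈H
    ... | inj₂ x≈y+p =
      resp-≈ (≈ᴹ-trans (+ᴹ-congʳ x≈y+p) (x+y+y≈x y p)) (+-closed x∈H p∈H)

  -- The third isomorphism theorem: both quotients have the same carrier and the same equality,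
  -- namely that the difference lies in `H`, so the basis carries over unchanged.
  image-isHyperplane : IsHyperplane V H → IsHyperplane (V / line V p) image
  image-isHyperplane dim = record
    { basis       = basis
    ; independent = independent
    ; spanning    = spanning
    }
    where open HasDimension dim

module TwoHole {s N′ N} (H : Subspace (𝔽₂^ s)) (M : Vector (Vec Bool s) N)
  (twoHoles : ExactlyTwo (λ i → Subspace.member H (M i)))
  (pairs : Pairing _≟_ N′ M) where

  open CharacteristicTwo (𝔽₂^ s)
  open Subspace H

  σ = proj₁ pairs
  equal = proj₂ pairs
  open Inverse σ using (strictlyInverseˡ; strictlyInverseʳ) renaming (to to σ⟨_⟩; from to σ⁻¹)

  i₀ = proj₁ twoHoles
  j₀ = proj₁ (proj₂ twoHoles)

  p : Vec Bool s
  p = M i₀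

  p∈H : member p
  p∈H = proj₁ (proj₂ (proj₂ (proj₂ twoHoles)))

  only : ∀ k → member (M k) → k ≡ i₀ ⊎ k ≡ j₀
  only = proj₂ (proj₂ (proj₂ (proj₂ (proj₂ twoHoles))))

  w : Vector (Vec Bool s) N′
  w j = M σ⟨ inj₁ j ⟩

  pairOf : Fin N → Fin N′
  pairOf = [ id , id ]′ ∘ σ⁻¹

  M≡w : ∀ i → M i ≡ w (pairOf i)
  M≡w i = trans (cong M (sym (strictlyInverseˡ i))) (Mσ≡w (σ⁻¹ i))
    where
    Mσ≡w : ∀ a → M σ⟨ a ⟩ ≡ w ([ id , id ]′ a)
    Mσ≡w (inj₁ j) = refl
    Mσ≡w (inj₂ j) = sym (equal j)

  hole : Fin N′
  hole = pairOf i₀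

  w-hole : w hole ≡ p
  w-hole = sym (M≡w i₀)

  -- If `w j` lies in `H`, then so does its equal partner. Their two distinct positions are both
  -- among `i₀` and `j₀`, hence one of them is `i₀`.
  w∈H⇒hole : ∀ j → member (w j) → j ≡ hole
  w∈H⇒hole j wj∈H = compare (only σ⟨ inj₁ j ⟩ wj∈H) (only σ⟨ inj₂ j ⟩ (resp-≈ (equal j) wj∈H))
    where
    found : ∀ a → σ⟨ a ⟩ ≡ i₀ → [ id , id ]′ a ≡ hole
    found a σa≡i₀ = cong [ id , id ]′ (trans (sym (strictlyInverseʳ a)) (cong σ⁻¹ σa≡i₀))

    compare : σ⟨ inj₁ j ⟩ ≡ i₀ ⊎ σ⟨ inj₁ j ⟩ ≡ j₀ → σ⟨ inj₂ j ⟩ ≡ i₀ ⊎ σ⟨ inj₂ j ⟩ ≡ j₀ → j ≡ hole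
    compare (inj₁ e) _        = found (inj₁ j) e
    compare (inj₂ e) (inj₁ f) = found (inj₂ j) f
    compare (inj₂ e) (inj₂ f) = contradiction
      (trans (sym (strictlyInverseʳ (inj₁ j)))
        (trans (cong σ⁻¹ (trans e (sym f))) (strictlyInverseʳ (inj₂ j)))) λ ()

  -- Adding the sum of all requests w j to the one in H makes the sum zero.
  u : Vector (Vec Bool s) N′
  u = updateAt w hole (_+ᴹ sum w)

  sum-u : sum u ≡ 0ᴹ
  sum-u = trans (sum-updateAt +ᴹ-commutativeMonoid w hole (sum w)) (x+x≈0 (sum w))

  u-crossing : ∀ n → N′ ≡ n + n → IsHyperplane (𝔽₂^ s) H → ∀ j → ¬ member (u j)
  u-crossing n N′≡n+n dim j uj∈H with j Fin.≟ hole
  ... | no j≢hole =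
    j≢hole (w∈H⇒hole j (subst member (Vector.updateAt-minimal j hole w j≢hole) uj∈H))
  -- At the hole `u` is `p + sum w`, so its membership in `H` would put `sum w` in `H`. Modulo `H`,
  -- only the summand at the hole vanishes, which leaves an odd number of generators.
  ... | yes refl = DimensionOne.sum-with-one-zero (𝔽₂^ s / H) dim n N′≡n+n w hole
    (member⇒≈/0 (𝔽₂^ s) H (subst member (sym w-hole) p∈H))
    (λ i i≢hole wi≈0 → i≢hole (w∈H⇒hole i (≈/0⇒member (𝔽₂^ s) H wi≈0)))
    (member⇒≈/0 (𝔽₂^ s) H sum∈H)
    where
    sum∈H : member (sum w)
    sum∈H = subst member (x+[x+y]≈y p (sum w)) (+-closed p∈H
      (subst member (trans (Vector.updateAt-updates hole w) (cong (_+ᴹ sum w) w-hole)) uj∈H))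

  open LeftModule (𝔽₂^ s / line (𝔽₂^ s) p) using () renaming (_≈ᴹ_ to _≈/_)

  -- The hole, whose request was altered, is lifted to cosets; every other edge keeps its request
  -- and is lifted to parallel edges.
  kind : ∀ j → u j ≈/ w j ⊎ w j ≡ p
  kind j with j Fin.≟ hole
  ... | yes refl   = inj₂ w-hole
  ... | no  j≢hole = inj₁ (≈⇒≈/ (𝔽₂^ s) (line (𝔽₂^ s) p) (Vector.updateAt-minimal j hole w j≢hole))

-- The cases `s = 2` and `s ≥ 3`.

two-dimensional : (bSolution : BSolution) (H : Subspace (𝔽₂^ 2)) →
  ∀ {N} (M : Vector (Vec Bool 2) N) → (∀ i → M i ≢ replicate 2 false) →
  ExactlyTwo (λ i → Subspace.member H (M i)) → Pairing _≟_ 1 M →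
  Σ[ S ∈ HadamardPairSolution (𝔽₂^ 2) M ] ConstructedByLifting bSolution H S
two-dimensional bSolution H M nonzero twoHoles pairs =
  L.solution , record
    { p            = p
    ; p∈H          = p∈H
    ; p≢0          = nonzero i₀
    ; dimension    = dimension
    ; construction = inj₁ (refl , λ i → coset-pair (𝔽₂^ 2) p (trans (sums i) (M≡p i)))
    }
  where
  open TwoHole H M twoHoles pairs
  dimension = line-quotient-dimension 1 p (nonzero i₀)

  w≡p : ∀ j → w j ≡ p
  -- There is a single pair, so it is the hole.
  w≡p zero with hole | w-hole
  ... | zero | e = e

  module L = Lift (𝔽₂^ 2) p (nonzero i₀) M
    (DimensionOne.solution (𝔽₂^ 2 / line (𝔽₂^ 2) p) dimension) σ equal (inj₂ ∘ w≡p)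
  open HadamardPairSolution L.solution using (sums)

  M≡p : ∀ i → M i ≡ p
  M≡p i = trans (M≡w i) (w≡p (pairOf i))

2^[1+n]≡2^n+2^n : ∀ n → 2 ^ suc n ≡ 2 ^ n + 2 ^ n
2^[1+n]≡2^n+2^n n = cong (2 ^ n +_) (ℕ.+-identityʳ (2 ^ n))

higher-dimensional : (bSolution : BSolution) → ∀ t (H : Subspace (𝔽₂^ suc (suc (suc t)))) →
  IsHyperplane (𝔽₂^ suc (suc (suc t))) H →
  ∀ {N} (M : Vector (Vec Bool (suc (suc (suc t)))) N) →
  (∀ i → M i ≢ replicate (suc (suc (suc t))) false) →
  ExactlyTwo (λ i → Subspace.member H (M i)) → Pairing _≟_ (2 ^ suc t) M →
  Σ[ S ∈ HadamardPairSolution (𝔽₂^ suc (suc (suc t))) M ] ConstructedByLifting bSolution H S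
higher-dimensional bSolution t H H-hyperplane M nonzero twoHoles pairs =
  L.solution , record
    { p            = p
    ; p∈H          = p∈H
    ; p≢0          = nonzero i₀
    ; dimension    = dimension
    ; construction = inj₂ (I , L.isLift)
    }
  where
  V = 𝔽₂^ suc (suc (suc t))

  open TwoHole H M twoHoles pairs
  dimension = line-quotient-dimension (suc (suc t)) p (nonzero i₀)

  I : AllCrossingHallInstance (V / line V p) (suc (suc t))
  I = record
    { request      = u
    ; zero-sum     = ≈⇒≈/ V (line V p) sum-u
    ; hyperplane   = image V H p∈H
    ; isHyperplane = image-isHyperplane V H p∈H H-hyperplane
    -- The number of quotient requests, `2 ^ suc t`, is even because `s` is at least 3; for `s = 2`
    -- it would be 1.
    ; crossing     = u-crossing (2 ^ t) (2^[1+n]≡2^n+2^n t) H-hyperplane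
    }

  module L = Lift V p (nonzero i₀) M (bSolution (V / line V p) dimension I) σ equal kind

theorem25 : (bSolution : BSolution) →
    ∀ (s : ℕ) → 2 ≤ s →
    (H : Subspace (𝔽₂^ s)) → IsHyperplane (𝔽₂^ s) H →
    (M : Vector (Vec Bool s) (2 ^ (s ∸ 1))) →
    (∀ i → M i ≢ replicate s false) →
    sumᵥ M ≡ replicate s false →
    ExactlyTwo (λ i → Subspace.member H (M i)) →
    (∀ i → 2 ∣ multiplicity M (M i)) →
    Σ[ S ∈ HadamardPairSolution (𝔽₂^ s) M ] ConstructedByLifting bSolution H S
theorem25 bSolution (suc (suc zero)) (s≤s (s≤s _)) H _ M nonzero _ twoHoles even =
  two-dimensional bSolution H M nonzero twoHoles (pairing _≟_ 1 refl M even)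
theorem25 bSolution (suc (suc (suc t))) (s≤s (s≤s _)) H H-hyperplane M nonzero _ twoHoles even =
  higher-dimensional bSolution t H H-hyperplane M nonzero twoHoles
    (pairing _≟_ (2 ^ suc t) (2^[1+n]≡2^n+2^n (suc t)) M even)
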